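{- Let $P$ be a plane tree with an even number $n$ of vertices. Then the parity of the pr-tree obtained from $P$ by choosing a root vertex (and a marked edge at it) does not depend on the choice of the root vertex: any two pr-trees obtained from $P$ in this way are both even or both odd.
   Context: A plane tree is a finite tree embedded in the plane (equivalently, a tree with a cyclic counterclockwise order on the edges at each vertex). A pr-tree (plane rooted tree) is obtained from a plane tree by choosing a root vertex and a marked edge incident to the root. It is drawn growing downwards from the root with the marked edge leftmost; the children of each vertex are then ordered from left to right: at the root, the edges are taken in counterclockwise order starting from the marked edge, and at any other vertex the edges to children are taken in counterclockwise order starting just after the edge to the parent. (For a fixed root, the parity defined below does not depend on the choice of the marked edge.) Bracket code: walk around the tree starting at the root, visiting the children of each vertex from left to right (depth-first); write an opening bracket when a vertex is met for the first time and a closing bracket when it is met for the last time. Thus, recursively, the code of a pr-tree whose root has pr-subtrees $T_1,\dots,T_s$ (left to right) is $(\,c(T_1)\cdots c(T_s)\,)$, and the one-vertex tree has code $()$. An inversion in a bracket code is a pair consisting of a closing bracket and an opening bracket, not necessarily adjacent, such that the closing bracket occurs before the opening bracket. A pr-tree is even if the number of inversions in its bracket code is even, and odd otherwise; this is its parity. -}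

module Defs where

open import Data.Fin using (Fin; zero; suc)
open import Data.Fin.Properties using (injective⇒≤)
open import Data.List using (List; []; _∷_; _++_; _∷ʳ_; length; lookup)
open import Data.List.Membership.Propositional using (_∈_; _∉_)
open import Data.List.Membership.Propositional.Properties
  using (∈-++⁺ˡ; ∈-++⁺ʳ; ∈-++⁻; ∈-∃++; ∈-lookup)
open import Data.List.Relation.Binary.Pointwise using (Pointwise; []; _∷_)
open import Data.List.Relation.Unary.All as All using (All; []; _∷_)
open import Data.List.Relation.Unary.All.Properties using (¬Any⇒All¬; ++⁻ˡ)
open import Data.List.Relation.Unary.AllPairs using ([]; _∷_)
open import Data.List.Relation.Unary.Any using (here; there)
open import Data.List.Relation.Unary.Linked using (Linked; []; [-]; _∷_)
open import Data.List.Relation.Unary.Unique.Propositional using (Unique)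
open import Data.Nat using (ℕ; zero; suc; _+_; _≤_; s≤s; z≤n; NonZero; parity)
open import Data.Nat.Properties using (+-suc; ≤-trans; m≤m+n; 1+n≰n)
open import Data.Parity using (Parity)
open import Data.Product using (∃; _×_; _,_)
open import Data.Sum using (inj₁; inj₂)
open import Relation.Binary.Construct.Closure.ReflexiveTransitive using (Star)
open import Relation.Binary.PropositionalEquality
  using (_≡_; _≢_; refl; sym; cong; subst)
open import Relation.Nullary using (¬_; contradiction)

private
  variable
    n : ℕ

-- `nbrs v` lists the neighbours of v (equivalently, since the graph is simple,
-- the edges at v) in counterclockwise order.  Only the cyclic order is
-- meaningful: where the list starts is an arbitrary choice, and everything
-- below that uses `nbrs` first rotates it to start at a given edge.
record PlaneTree (n : ℕ) : Set where
  field
    nbrs : Fin n → List (Fin n)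

  Adj : Fin n → Fin n → Set
  Adj v w = w ∈ nbrs v

  IsCycle : Fin n → List (Fin n) → Set
  IsCycle v vs = 2 ≤ length vs × Unique (v ∷ vs) × Linked Adj (v ∷ vs ∷ʳ v)

  field
    nonempty    : NonZero n
    nbrs-unique : ∀ v → Unique (nbrs v)
    adj-sym     : ∀ {v w} → Adj v w → Adj w v
    adj-irrefl  : ∀ {v} → ¬ Adj v v
    connected   : ∀ v w → Star Adj v w
    acyclic     : ∀ {v vs} → ¬ IsCycle v vs

-- A pr-tree, as the root together with its pr-subtrees from left to right.
data PRTree : Set where
  node : List PRTree → PRTree

module _ (P : PlaneTree n) where
  open PlaneTree P

  -- `Hanging v w T`: T is the pr-subtree at w when v is the parent of w.  The
  -- children of w are its neighbours after v in the cyclic order, up to but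
  -- not including v again.
  data Hanging (v w : Fin n) : PRTree → Set where
    hanging : ∀ as bs {Ts} → nbrs w ≡ as ++ v ∷ bs →
              Pointwise (Hanging w) (bs ++ as) Ts → Hanging v w (node Ts)

  -- `Rooted r u T`: T is the pr-tree obtained by choosing the root r and the
  -- marked edge from r to u.
  data Rooted (r u : Fin n) : PRTree → Set where
    rooted : ∀ as bs {Ts} → nbrs r ≡ as ++ u ∷ bs →
             Pointwise (Hanging r) (u ∷ bs ++ as) Ts → Rooted r u (node Ts)

data Bracket : Set where
  ⟪ ⟫ : Bracket

mutual
  code : PRTree → List Bracket
  code (node Ts) = ⟪ ∷ codes Ts ∷ʳ ⟫

  codes : List PRTree → List Bracket
  codes []       = []
  codes (T ∷ Ts) = code T ++ codes Ts

openings : List Bracket → ℕ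
openings []       = 0
openings (⟪ ∷ bs) = suc (openings bs)
openings (⟫ ∷ bs) = openings bs

-- Each closing bracket is inverted with exactly the opening brackets after it.
inversions : List Bracket → ℕ
inversions []       = 0
inversions (⟪ ∷ bs) = inversions bs
inversions (⟫ ∷ bs) = openings bs + inversions bs

treeParity : PRTree → Parity
treeParity T = parity (inversions (code T))

-- `Rooted` is inhabited for every choice of root and marked edge: the vertices
-- on a branch are distinct, because the tree has no cycle, so every branch ends.
private
  unique-drop-middle : ∀ {A : Set} (as : List A) {v bs} → Unique (as ++ v ∷ bs) →
                       v ∉ bs ++ as
  unique-drop-middle as {v} {bs} uq v∈ with ∈-++⁻ bs v∈
  ... | inj₁ v∈bs = right as uq v∈bs
    where
    right : ∀ as → Unique (as ++ v ∷ bs) → v ∉ bs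
    right []       (px ∷ _) v∈bs = All.lookup px v∈bs refl
    right (_ ∷ as) (_ ∷ uq) v∈bs = right as uq v∈bs
  ... | inj₂ v∈as = left as uq v∈as
    where
    left : ∀ as → Unique (as ++ v ∷ bs) → v ∉ as
    left (a ∷ as) (px ∷ _) (here refl)  = All.lookup px (∈-++⁺ʳ as (here refl)) refl
    left (a ∷ as) (_ ∷ uq) (there v∈as) = left as uq v∈as

  lookup-inj : ∀ {A : Set} {xs : List A} → Unique xs →
               ∀ i j → lookup xs i ≡ lookup xs j → i ≡ j
  lookup-inj             (px ∷ uq) zero    zero    eq = refl
  lookup-inj {xs = _ ∷ xs} (px ∷ uq) zero    (suc j) eq =
    contradiction eq (All.lookup px (∈-lookup {xs = xs} j))
  lookup-inj {xs = _ ∷ xs} (px ∷ uq) (suc i) zero    eq =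
    contradiction (sym eq) (All.lookup px (∈-lookup {xs = xs} i))
  lookup-inj             (px ∷ uq) (suc i) (suc j) eq = cong suc (lookup-inj uq i j eq)

  unique⇒length≤ : {xs : List (Fin n)} → Unique xs → length xs ≤ n
  unique⇒length≤ {xs = xs} uq =
    injective⇒≤ {f = lookup xs} (λ {i} {j} → lookup-inj uq i j)

  unique-snoc : ∀ {A : Set} (xs : List A) {c ys} → Unique (xs ++ c ∷ ys) → Unique (c ∷ xs)
  unique-snoc []       _         = [] ∷ []
  unique-snoc (x ∷ xs) (px ∷ uq) with unique-snoc xs uq
  ... | c∉ ∷ uq′ =
    ((λ c≡x → All.lookup px (∈-++⁺ʳ xs (here refl)) (sym c≡x)) ∷ c∉) ∷ (++⁻ˡ xs px ∷ uq′)

  linked-prefix : ∀ {A : Set} {R : A → A → Set} (xs : List A) {c ys} →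
                  Linked R (xs ++ c ∷ ys) → Linked R (xs ∷ʳ c)
  linked-prefix []           _         = [-]
  linked-prefix (x ∷ [])     (r ∷ _)   = r ∷ [-]
  linked-prefix (x ∷ y ∷ xs) (r ∷ rs)  = r ∷ linked-prefix (y ∷ xs) rs

module _ (P : PlaneTree n) where
  open PlaneTree P

  private
    pointwise-exists : ∀ {v} ws → (∀ {w} → w ∈ ws → ∃ (Hanging P v w)) →
                       ∃ (Pointwise (Hanging P v) ws)
    pointwise-exists []       f = [] , []
    pointwise-exists (w ∷ ws) f with f (here refl) | pointwise-exists ws (λ w∈ → f (there w∈))
    ... | T , h | Ts , hs = T ∷ Ts , h ∷ hs

    fresh : ∀ {v w p c} → Linked Adj (w ∷ v ∷ p) → Unique (w ∷ v ∷ p) →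
            Adj w c → c ≢ v → c ∉ w ∷ v ∷ p
    fresh lk uq wc c≢v (here refl)         = adj-irrefl wc
    fresh lk uq wc c≢v (there (here c≡v))  = c≢v c≡v
    fresh {v} {w} lk uq wc c≢v (there (there c∈p)) with ∈-∃++ c∈p
    ... | xs , ys , refl =
      acyclic ( s≤s (s≤s z≤n)
              , unique-snoc (w ∷ v ∷ xs) uq
              , adj-sym wc ∷ linked-prefix (w ∷ v ∷ xs) lk)

    hanging-exists : ∀ k {v w p} → n ≤ k + length (v ∷ p) →
                     Linked Adj (w ∷ v ∷ p) → Unique (w ∷ v ∷ p) → ∃ (Hanging P v w)
    hanging-exists zero    n≤ lk uq =
      contradiction (≤-trans (unique⇒length≤ uq) n≤) 1+n≰n
    hanging-exists (suc k) {v} {w} {p} n≤ lk@(wv ∷ _) uq with ∈-∃++ wv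
    ... | as , bs , eq with pointwise-exists (bs ++ as) child
      where
      v∉ : v ∉ bs ++ as
      v∉ = unique-drop-middle as (subst Unique eq (nbrs-unique w))

      into : ∀ {c} → c ∈ bs ++ as → Adj w c
      into {c} c∈ with ∈-++⁻ bs c∈
      ... | inj₁ c∈bs = subst (c ∈_) (sym eq) (∈-++⁺ʳ as (there c∈bs))
      ... | inj₂ c∈as = subst (c ∈_) (sym eq) (∈-++⁺ˡ c∈as)

      child : ∀ {c} → c ∈ bs ++ as → ∃ (Hanging P w c)
      child {c} c∈ =
        hanging-exists k (subst (n ≤_) (sym (+-suc k (length (v ∷ p)))) n≤)
          (adj-sym (into c∈) ∷ lk)
          (¬Any⇒All¬ _ (fresh lk uq (into c∈) (λ { refl → v∉ c∈ })) ∷ uq)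
    ... | Ts , hs = node Ts , hanging as bs eq hs

  rooted-exists : ∀ {r u} → Adj r u → ∃ (Rooted P r u)
  rooted-exists {r} {u} ru with ∈-∃++ ru
  ... | as , bs , eq with pointwise-exists (u ∷ bs ++ as) child
    where
    into : ∀ {c} → c ∈ u ∷ bs ++ as → Adj r c
    into (here refl) = ru
    into {c} (there c∈) with ∈-++⁻ bs c∈
    ... | inj₁ c∈bs = subst (c ∈_) (sym eq) (∈-++⁺ʳ as (there c∈bs))
    ... | inj₂ c∈as = subst (c ∈_) (sym eq) (∈-++⁺ˡ c∈as)

    child : ∀ {c} → c ∈ u ∷ bs ++ as → ∃ (Hanging P r c)
    child c∈ = hanging-exists n (m≤m+n n _) (adj-sym (into c∈) ∷ [-])
                 (((λ { refl → adj-irrefl (into c∈) }) ∷ []) ∷ [] ∷ [])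
  ... | Ts , hs = node Ts , rooted as bs eq hs

{-# OPTIONS --safe #-}

-- Write |F| for the number of vertices of a forest F.  The code of the forest
-- F G has inv F + inv G + |F| |G| inversions, which is symmetric in F and G, so
-- rotating the pr-subtrees at the root preserves the number of inversions.  If
-- the edge from r to u has the forests F at r and G at u on its two sides, the
-- pr-trees rooted at r and at u with this edge marked have
-- inv F + inv G + (1 + |G|) |F| and inv F + inv G + (1 + |F|) |G| inversions; as
-- |F| + |G| + 2 = n is even, these have the same parity.
--
-- That a pr-tree of P has n vertices amounts to the absence of repetitions: a
-- vertex occurring twice would give a non-backtracking walk that visits it
-- twice, hence a cycle.

module Submission where

open import Defs
open import Data.Fin using (Fin; zero; suc)
open import Data.Fin.Properties using (injective⇒≤)
open import Data.List using (List; []; _∷_; _++_; _∷ʳ_; length; lookup)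
open import Data.List.Membership.Propositional using (_∈_; _∉_)
open import Data.List.Membership.Propositional.Properties
  using (∈-++⁺ˡ; ∈-++⁺ʳ; ∈-++⁻; ∈-∃++; ∈-lookup)
open import Data.List.Properties using (length-++; ++-assoc; ∷-injective)
open import Data.List.Relation.Binary.Permutation.Propositional
  using (_↭_; ↭-sym; ↭-trans; ↭-reflexive; ↭⇒↭ₛ)
open import Data.List.Relation.Binary.Permutation.Propositional.Properties
  using (∈-resp-↭; ++-comm)
import Data.List.Relation.Binary.Permutation.Setoid.Properties as Permₛ
open import Data.List.Relation.Binary.Pointwise using (Pointwise; []; _∷_; ++⁺)
open import Data.List.Relation.Unary.All as All using (All; []; _∷_)
open import Data.List.Relation.Unary.All.Properties using (¬Any⇒All¬; All¬⇒¬Any; ++⁻ˡ)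
open import Data.List.Relation.Unary.AllPairs using ([]; _∷_)
open import Data.List.Relation.Unary.Any as Any using (here; there)
open import Data.List.Relation.Unary.Any.Properties using (lookup-index)
open import Data.List.Relation.Unary.Linked using (Linked; [-]; _∷_)
open import Data.List.Relation.Unary.Unique.Propositional using (Unique)
import Data.List.Relation.Unary.Unique.Propositional.Properties as Unique
open import Data.Nat using (ℕ; suc; _+_; _*_; s≤s; z≤n; parity)
open import Data.Nat.Divisibility using (_∣_; divides)
open import Data.Nat.Properties using (≤-antisym; +-comm; +-identityʳ; *-zeroʳ)
open import Data.Nat.Tactic.RingSolver using (solve-∀)
open import Data.Parity as ℙ using (0ℙ; 1ℙ)
open import Data.Parity.Properties using (+-homo-+; *-homo-*) renaming (*-zeroʳ to ℙ-*-zeroʳ)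
open import Data.Product using (∃; ∃₂; _×_; _,_)
open import Data.Sum using (inj₁; inj₂)
open import Function using (_∘_)
open import Relation.Binary.Construct.Closure.ReflexiveTransitive using (Star; ε; _◅_)
open import Relation.Binary.PropositionalEquality
  using (_≡_; _≢_; refl; sym; trans; cong; cong₂; subst; setoid; module ≡-Reasoning)
open import Relation.Nullary using (contradiction)

private
  variable
    n : ℕ
    A B : Set

-- Lists without repetitions: length, rotation and splitting.

lookup-injective : {xs : List A} → Unique xs → ∀ i j → lookup xs i ≡ lookup xs j → i ≡ j
lookup-injective {xs = _ ∷ _}  _          zero    zero    eq = refl
lookup-injective {xs = _ ∷ xs} (x∉ ∷ _)   zero    (suc j) eq =
  contradiction eq (All.lookup x∉ (∈-lookup {xs = xs} j))
lookup-injective {xs = _ ∷ xs} (x∉ ∷ _)   (suc i) zero    eq =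
  contradiction (sym eq) (All.lookup x∉ (∈-lookup {xs = xs} i))
lookup-injective {xs = _ ∷ _}  (_ ∷ uniq) (suc i) (suc j) eq =
  cong suc (lookup-injective uniq i j eq)

-- Two injections: `lookup` from positions of `xs` to `Fin n`, and the index of an occurrence back.
enumeration-length : {xs : List (Fin n)} → Unique xs → (∀ x → x ∈ xs) → length xs ≡ n
enumeration-length {xs = xs} uniq cover = ≤-antisym
  (injective⇒≤ {f = lookup xs} (λ {i} {j} → lookup-injective uniq i j))
  (injective⇒≤ {f = λ x → Any.index (cover x)} λ {x} {y} eq →
    trans (lookup-index (cover x)) (trans (cong (lookup xs) eq) (sym (lookup-index (cover y)))))

rotation : ∀ (as : List A) {bs cs} → cs ≡ as ++ bs → cs ↭ bs ++ as
rotation as {bs} eq = ↭-trans (↭-reflexive eq) (++-comm as bs)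

unique-resp-↭ : {xs ys : List A} → xs ↭ ys → Unique xs → Unique ys
unique-resp-↭ p = Permₛ.Unique-resp-↭ (setoid _) (↭⇒↭ₛ p)

-- Puts the repeated vertex of a walk in front of the vertices between its two visits, as `IsCycle`
-- requires.
unique-snoc : ∀ (xs : List A) {c ys} → Unique (xs ++ c ∷ ys) → Unique (c ∷ xs)
unique-snoc []       _            = [] ∷ []
unique-snoc (x ∷ xs) (x∉ ∷ uniq) with unique-snoc xs uniq
... | c∉ ∷ uniq′ =
  ((λ c≡x → All.lookup x∉ (∈-++⁺ʳ xs (here refl)) (sym c≡x)) ∷ c∉) ∷ ++⁻ˡ xs x∉ ∷ uniq′

-- Since `v` occurs only once, its position fixes the splitting; hence the order of the children
-- after a given parent is determined.
unique-split : ∀ (as {as′} : List A) {v bs bs′} → Unique (as ++ v ∷ bs) →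
               as ++ v ∷ bs ≡ as′ ++ v ∷ bs′ → as ≡ as′ × bs ≡ bs′
unique-split []       {[]}      _           refl = refl , refl
unique-split []       {_ ∷ as′} (v∉ ∷ _)    refl =
  contradiction refl (All.lookup v∉ (∈-++⁺ʳ as′ (here refl)))
unique-split (_ ∷ as) {[]}      (v∉ ∷ _)    refl =
  contradiction refl (All.lookup v∉ (∈-++⁺ʳ as (here refl)))
unique-split (_ ∷ as) {_ ∷ _}   (_ ∷ uniq)  eq with ∷-injective eq
... | refl , eq′ with unique-split as uniq eq′
... | refl , refl = refl , refl

linked-prefix : ∀ {R : A → A → Set} xs {c ys} → Linked R (xs ++ c ∷ ys) → Linked R (xs ∷ʳ c)
linked-prefix []           _        = [-]
linked-prefix (x ∷ [])     (r ∷ _)  = r ∷ [-]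
linked-prefix (x ∷ y ∷ xs) (r ∷ rs) = r ∷ linked-prefix (y ∷ xs) rs

pointwise-++⁻ : ∀ {R : A → B → Set} xs {ys zs} → Pointwise R (xs ++ ys) zs →
                ∃₂ λ us vs → zs ≡ us ++ vs × Pointwise R xs us × Pointwise R ys vs
pointwise-++⁻ []       rs       = [] , _ , refl , [] , rs
pointwise-++⁻ (x ∷ xs) (r ∷ rs) with pointwise-++⁻ xs rs
... | us , vs , refl , rs₁ , rs₂ = _ ∷ us , vs , refl , r ∷ rs₁ , rs₂

-- Inversions in the codes of forests.

closings : List Bracket → ℕ
closings []       = 0
closings (⟪ ∷ bs) = closings bs
closings (⟫ ∷ bs) = suc (closings bs)

openings-++ : ∀ xs ys → openings (xs ++ ys) ≡ openings xs + openings ys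
openings-++ []       ys = refl
openings-++ (⟪ ∷ xs) ys = cong suc (openings-++ xs ys)
openings-++ (⟫ ∷ xs) ys = openings-++ xs ys

closings-++ : ∀ xs ys → closings (xs ++ ys) ≡ closings xs + closings ys
closings-++ []       ys = refl
closings-++ (⟪ ∷ xs) ys = closings-++ xs ys
closings-++ (⟫ ∷ xs) ys = cong suc (closings-++ xs ys)

-- The product counts the mixed pairs: each closing bracket of `xs` precedes every opening bracket
-- of `ys`.
inversions-++ : ∀ xs ys →
  inversions (xs ++ ys) ≡ inversions xs + inversions ys + closings xs * openings ys
inversions-++ []       ys = sym (+-identityʳ _)
inversions-++ (⟪ ∷ xs) ys = inversions-++ xs ys
inversions-++ (⟫ ∷ xs) ys = trans
  (cong₂ _+_ (openings-++ xs ys) (inversions-++ xs ys))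
  (regroup (openings xs) (openings ys) (inversions xs) (inversions ys) (closings xs * openings ys))
  where
  regroup : ∀ o o′ i i′ c → (o + o′) + (i + i′ + c) ≡ (o + i) + i′ + (o′ + c)
  regroup = solve-∀

codes-++ : ∀ Ts Us → codes (Ts ++ Us) ≡ codes Ts ++ codes Us
codes-++ []       Us = refl
codes-++ (T ∷ Ts) Us =
  trans (cong (code T ++_) (codes-++ Ts Us)) (sym (++-assoc (code T) _ _))

-- The number of vertices, as each vertex writes exactly one opening bracket.
size : List PRTree → ℕ
size Ts = openings (codes Ts)

inv : List PRTree → ℕ
inv Ts = inversions (codes Ts)

openings-node : ∀ Ts → openings (code (node Ts)) ≡ suc (size Ts)
openings-node Ts = cong suc (trans (openings-++ (codes Ts) _) (+-identityʳ _))

-- The outer pair opens before and closes after everything else, so it takes part in no inversion.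
inversions-node : ∀ Ts → inversions (code (node Ts)) ≡ inv Ts
inversions-node Ts = begin
  inversions (codes Ts ∷ʳ ⟫)              ≡⟨ inversions-++ (codes Ts) _ ⟩
  inv Ts + 0 + closings (codes Ts) * 0    ≡⟨ cong₂ _+_ (+-identityʳ _) (*-zeroʳ (closings (codes Ts))) ⟩
  inv Ts + 0                              ≡⟨ +-identityʳ _ ⟩
  inv Ts                                  ∎
  where open ≡-Reasoning

mutual
  code-balanced : ∀ T → closings (code T) ≡ openings (code T)
  code-balanced (node Ts) = begin
    closings (codes Ts ∷ʳ ⟫)    ≡⟨ closings-++ (codes Ts) _ ⟩
    closings (codes Ts) + 1     ≡⟨ cong (_+ 1) (codes-balanced Ts) ⟩
    size Ts + 1                 ≡⟨ +-comm (size Ts) 1 ⟩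
    suc (size Ts)               ≡⟨ openings-node Ts ⟨
    openings (code (node Ts))   ∎
    where open ≡-Reasoning

  codes-balanced : ∀ Ts → closings (codes Ts) ≡ size Ts
  codes-balanced []       = refl
  codes-balanced (T ∷ Ts) = begin
    closings (code T ++ codes Ts)           ≡⟨ closings-++ (code T) _ ⟩
    closings (code T) + closings (codes Ts) ≡⟨ cong₂ _+_ (code-balanced T) (codes-balanced Ts) ⟩
    openings (code T) + size Ts             ≡⟨ openings-++ (code T) _ ⟨
    size (T ∷ Ts)                           ∎
    where open ≡-Reasoning

inv-++ : ∀ Ts Us → inv (Ts ++ Us) ≡ inv Ts + inv Us + size Ts * size Us
inv-++ Ts Us = begin
  inv (Ts ++ Us)                                        ≡⟨ cong inversions (codes-++ Ts Us) ⟩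
  inversions (codes Ts ++ codes Us)                     ≡⟨ inversions-++ (codes Ts) _ ⟩
  inv Ts + inv Us + closings (codes Ts) * size Us       ≡⟨ cong (λ k → inv Ts + inv Us + k * size Us) (codes-balanced Ts) ⟩
  inv Ts + inv Us + size Ts * size Us                   ∎
  where open ≡-Reasoning

inv-rotate : ∀ Ts Us → inv (Ts ++ Us) ≡ inv (Us ++ Ts)
inv-rotate Ts Us = begin
  inv (Ts ++ Us)                        ≡⟨ inv-++ Ts Us ⟩
  inv Ts + inv Us + size Ts * size Us   ≡⟨ swap (inv Ts) (inv Us) (size Ts) (size Us) ⟩
  inv Us + inv Ts + size Us * size Ts   ≡⟨ inv-++ Us Ts ⟨
  inv (Us ++ Ts)                        ∎
  where
  open ≡-Reasoning
  swap : ∀ i j s t → i + j + s * t ≡ j + i + t * s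
  swap = solve-∀

size-∷ : ∀ Ts Us → size (node Ts ∷ Us) ≡ suc (size Ts) + size Us
size-∷ Ts Us = trans (openings-++ (code (node Ts)) _) (cong (_+ size Us) (openings-node Ts))

inv-∷ : ∀ Ts Us → inv (node Ts ∷ Us) ≡ inv Ts + inv Us + suc (size Ts) * size Us
inv-∷ Ts Us = begin
  inv (node Ts ∷ Us)
    ≡⟨ inversions-++ (code (node Ts)) _ ⟩
  inversions (code (node Ts)) + inv Us + closings (code (node Ts)) * size Us
    ≡⟨ cong₂ (λ i k → i + inv Us + k * size Us) (inversions-node Ts)
         (trans (code-balanced (node Ts)) (openings-node Ts)) ⟩
  inv Ts + inv Us + suc (size Ts) * size Us ∎
  where open ≡-Reasoning

treeParity-node : ∀ Ts → treeParity (node Ts) ≡ parity (inv Ts)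
treeParity-node Ts = cong parity (inversions-node Ts)

-- Parity when the root moves across the marked edge.

even-parity : ∀ {m} → 2 ∣ m → parity m ≡ 0ℙ
even-parity (divides q refl) = trans (*-homo-* q 2) (ℙ-*-zeroʳ (parity q))

even-sum : ∀ {s t} → parity (s + t) ≡ 0ℙ → parity s ≡ parity t
even-sum {s} {t} even with parity s | parity t | trans (sym (+-homo-+ s t)) even
... | 0ℙ | 0ℙ | _ = refl
... | 1ℙ | 1ℙ | _ = refl

-- Apart from the common term `i + j + s * t`, one side has an extra `t` and the other an extra `s`,
-- and these agree in parity.
parity-exchange : ∀ i j s t → parity (s + t) ≡ 0ℙ →
                  parity (i + j + suc s * t) ≡ parity (j + i + suc t * s)
parity-exchange i j s t even = begin
  parity (i + j + (t + s * t))                    ≡⟨ cong parity (expose i j s t) ⟩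
  parity (t + (i + j + s * t))                    ≡⟨ +-homo-+ t _ ⟩
  parity t ℙ.+ parity (i + j + s * t)             ≡⟨ cong (ℙ._+ parity (i + j + s * t)) (even-sum {s} {t} even) ⟨
  parity s ℙ.+ parity (i + j + s * t)             ≡⟨ +-homo-+ s _ ⟨
  parity (s + (i + j + s * t))                    ≡⟨ cong parity (expose′ i j s t) ⟩
  parity (j + i + (s + t * s))                    ∎
  where
  open ≡-Reasoning
  expose : ∀ i j s t → i + j + (t + s * t) ≡ t + (i + j + s * t)
  expose = solve-∀
  expose′ : ∀ i j s t → s + (i + j + s * t) ≡ j + i + (s + t * s)
  expose′ = solve-∀

treeParity-reroot : ∀ Ts Us → parity (openings (code (node (node Ts ∷ Us)))) ≡ 0ℙ →
                    treeParity (node (node Ts ∷ Us)) ≡ treeParity (node (node Us ∷ Ts))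
treeParity-reroot Ts Us even = begin
  treeParity (node (node Ts ∷ Us))                      ≡⟨ treeParity-node (node Ts ∷ Us) ⟩
  parity (inv (node Ts ∷ Us))                           ≡⟨ cong parity (inv-∷ Ts Us) ⟩
  parity (inv Ts + inv Us + suc (size Ts) * size Us)    ≡⟨ parity-exchange (inv Ts) (inv Us) (size Ts) (size Us) even′ ⟩
  parity (inv Us + inv Ts + suc (size Us) * size Ts)    ≡⟨ cong parity (inv-∷ Us Ts) ⟨
  parity (inv (node Us ∷ Ts))                           ≡⟨ treeParity-node (node Us ∷ Ts) ⟨
  treeParity (node (node Us ∷ Ts))                      ∎
  where
  open ≡-Reasoning
  even′ : parity (size Ts + size Us) ≡ 0ℙ
  -- The two ends of the marked edge add 2 to the vertex count, which `parity` removes by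
  -- computation.
  even′ = trans
    (cong parity (sym (trans (openings-node (node Ts ∷ Us)) (cong suc (size-∷ Ts Us))))) even

-- Vertices of the pr-subtrees of `P`.

module _ (P : PlaneTree n) where
  open PlaneTree P

  private
    variable
      u v w x y : Fin n
      p cs : List (Fin n)
      T T′ : PRTree
      Ts Ts′ : List PRTree

  Forest : Fin n → List (Fin n) → List PRTree → Set
  Forest w = Pointwise (Hanging P w)

  mutual
    vertices : Hanging P v w T → List (Fin n)
    vertices {w = w} (hanging _ _ _ hs) = w ∷ forestVertices hs

    forestVertices : Forest w cs Ts → List (Fin n)
    forestVertices []       = []
    forestVertices (h ∷ hs) = vertices h ++ forestVertices hs

  mutual
    length-vertices : (h : Hanging P v w T) → length (vertices h) ≡ openings (code T)
    length-vertices (hanging _ _ {Ts} _ hs) =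
      trans (cong suc (length-forestVertices hs)) (sym (openings-node Ts))

    length-forestVertices : (hs : Forest w cs Ts) → length (forestVertices hs) ≡ size Ts
    length-forestVertices []                = refl
    length-forestVertices {Ts = T ∷ _} (h ∷ hs) = trans (length-++ (vertices h))
      (trans (cong₂ _+_ (length-vertices h) (length-forestVertices hs))
             (sym (openings-++ (code T) _)))

  -- Non-backtracking walks and the absence of repeated vertices.

  data NonBacktracking : List (Fin n) → Set where
    edge : Adj v w → NonBacktracking (v ∷ w ∷ [])
    _∷_  : Adj u v × u ≢ w → NonBacktracking (v ∷ w ∷ p) → NonBacktracking (u ∷ v ∷ w ∷ p)

  walk : NonBacktracking p → Linked Adj p
  walk (edge vw)     = vw ∷ [-]
  walk ((uv , _) ∷ nb) = uv ∷ walk nb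

  -- The first return of a non-backtracking walk to a visited vertex closes a cycle.
  nonBacktracking⇒unique : NonBacktracking p → Unique p
  nonBacktracking⇒unique (edge vw) = ((λ { refl → adj-irrefl vw }) ∷ []) ∷ [] ∷ []
  nonBacktracking⇒unique {p = u ∷ p} nb@((uv , u≢w) ∷ nb′) = ¬Any⇒All¬ p u∉p ∷ uniq
    where
    uniq : Unique p
    uniq = nonBacktracking⇒unique nb′

    u∉p : u ∉ p
    u∉p u∈p with ∈-∃++ u∈p
    -- By the number of vertices between the two visits to `u`: none gives a loop, one a step back,
    -- two or more a cycle.
    ... | []        , _ , refl = adj-irrefl uv
    ... | _ ∷ []    , _ , refl = u≢w refl
    ... | q@(_ ∷ _ ∷ _) , _ , refl =
      acyclic (s≤s (s≤s z≤n) , unique-snoc q uniq , linked-prefix (u ∷ q) (walk nb))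

  children-unique : ∀ as {bs} → nbrs w ≡ as ++ v ∷ bs → Unique (v ∷ bs ++ as)
  children-unique as eq = unique-resp-↭ (rotation as eq) (nbrs-unique _)

  children-adj : ∀ as {bs} → nbrs w ≡ as ++ v ∷ bs → All (Adj w) (v ∷ bs ++ as)
  children-adj as eq = All.tabulate (∈-resp-↭ (↭-sym (rotation as eq)))

  -- The neighbour list has no repetitions, so every child of `w` differs from the parent `v` and
  -- the step to it does not turn back.
  extend-to-children : ∀ as {bs} → nbrs w ≡ as ++ v ∷ bs → NonBacktracking (w ∷ v ∷ p) →
                       All (λ c → NonBacktracking (c ∷ w ∷ v ∷ p)) (bs ++ as)
  extend-to-children as eq nb with children-unique as eq | children-adj as eq
  ... | v∉ ∷ _ | _ ∷ adj =
    All.zipWith (λ (v≢c , wc) → (adj-sym wc , v≢c ∘ sym) ∷ nb) (v∉ , adj)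

  mutual
    -- Prolonging the walk down the branch to `x` keeps it non-backtracking, so its new end `x`
    -- cannot be among the vertices already visited.
    vertices-avoid : (h : Hanging P v w T) → NonBacktracking (w ∷ v ∷ p) →
                     x ∈ vertices h → x ∉ v ∷ p
    vertices-avoid (hanging _ _ _ _) nb (here refl) x∈ with nonBacktracking⇒unique nb
    ... | w∉ ∷ _ = All¬⇒¬Any w∉ x∈
    vertices-avoid (hanging as bs eq hs) nb (there x∈) =
      forestVertices-avoid hs (extend-to-children as eq nb) x∈ ∘ there

    forestVertices-avoid : (hs : Forest w cs Ts) → All (λ c → NonBacktracking (c ∷ w ∷ p)) cs →
                           x ∈ forestVertices hs → x ∉ w ∷ p
    forestVertices-avoid (h ∷ hs) (nb ∷ nbs) x∈ with ∈-++⁻ (vertices h) x∈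
    ... | inj₁ x∈h  = vertices-avoid h nb x∈h
    ... | inj₂ x∈hs = forestVertices-avoid hs nbs x∈hs

  mutual
    -- The branch from `v` down to `x` is itself a non-backtracking walk, listed from the top so
    -- that it can be prolonged above `v`.
    descend : (h : Hanging P v w T) → Adj v w → x ∈ vertices h →
              ∃ λ p → NonBacktracking (v ∷ w ∷ p) × x ∈ w ∷ p
    descend (hanging _ _ _ _) vw (here refl) = [] , edge vw , here refl
    descend (hanging as bs eq hs) vw (there x∈)
      with children-unique as eq | children-adj as eq
    ... | v∉ ∷ _ | _ ∷ adj with forest-descend hs adj x∈
    ... | c , p , c∈ , nb , x∈p = c ∷ p , (vw , All.lookup v∉ c∈) ∷ nb , there x∈p

    forest-descend : (hs : Forest w cs Ts) → All (Adj w) cs → x ∈ forestVertices hs →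
                     ∃₂ λ c p → c ∈ cs × NonBacktracking (w ∷ c ∷ p) × x ∈ c ∷ p
    forest-descend (h ∷ hs) (wc ∷ adj) x∈ with ∈-++⁻ (vertices h) x∈
    ... | inj₁ x∈h with descend h wc x∈h
    ...   | p , nb , x∈p = _ , p , here refl , nb , x∈p
    forest-descend (h ∷ hs) (wc ∷ adj) x∈ | inj₂ x∈hs with forest-descend hs adj x∈hs
    ...   | c , p , c∈ , nb , x∈p = c , p , there c∈ , nb , x∈p

  mutual
    vertices-unique : (h : Hanging P v w T) → Unique (vertices h)
    vertices-unique (hanging as bs eq hs) with children-unique as eq | children-adj as eq
    ... | _ ∷ uniq | _ ∷ adj = node-unique hs uniq adj

    node-unique : (hs : Forest w cs Ts) → Unique cs → All (Adj w) cs →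
                  Unique (w ∷ forestVertices hs)
    node-unique hs uniq adj =
      ¬Any⇒All¬ _ (λ w∈ → forestVertices-avoid hs (All.map (edge ∘ adj-sym) adj) w∈ (here refl))
      ∷ forestVertices-unique hs uniq adj

    forestVertices-unique : (hs : Forest w cs Ts) → Unique cs → All (Adj w) cs →
                            Unique (forestVertices hs)
    forestVertices-unique []       _           _          = []
    forestVertices-unique (h ∷ hs) (c∉ ∷ uniq) (wc ∷ adj) =
      Unique.++⁺ (vertices-unique h) (forestVertices-unique hs uniq adj) λ (x∈h , x∈hs) →
        let _ , _ , d∈ , nb , x∈p = forest-descend hs adj x∈hs
        -- If `x` lay below two distinct children, the walk from the first child up to the parent
        -- and down through the second to `x` would be non-backtracking, and the first subtree
        -- avoids it.
        in vertices-avoid h ((adj-sym wc , All.lookup c∉ d∈) ∷ nb) x∈h (there x∈p)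

  -- Every vertex of `P` occurs.

  root∈vertices : (h : Hanging P v w T) → w ∈ vertices h
  root∈vertices (hanging _ _ _ _) = here refl

  roots∈forestVertices : (hs : Forest w cs Ts) → x ∈ cs → x ∈ forestVertices hs
  roots∈forestVertices (h ∷ hs) (here refl) = ∈-++⁺ˡ (root∈vertices h)
  roots∈forestVertices (h ∷ hs) (there x∈)  = ∈-++⁺ʳ (vertices h) (roots∈forestVertices hs x∈)

  mutual
    -- Each neighbour of a vertex is its parent or one of its children, so the only way out of the
    -- subtree is through `v`.
    vertices-closed : (h : Hanging P v w T) → x ∈ vertices h → Adj x y → y ∈ v ∷ vertices h
    vertices-closed (hanging as bs eq hs) (here refl) xy with ∈-resp-↭ (rotation as eq) xy
    ... | here refl = here refl
    ... | there y∈  = there (there (roots∈forestVertices hs y∈))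
    vertices-closed (hanging as bs eq hs) (there x∈) xy = there (forestVertices-closed hs x∈ xy)

    forestVertices-closed : (hs : Forest w cs Ts) → x ∈ forestVertices hs → Adj x y →
                            y ∈ w ∷ forestVertices hs
    forestVertices-closed (h ∷ hs) x∈ xy with ∈-++⁻ (vertices h) x∈
    ... | inj₁ x∈h with vertices-closed h x∈h xy
    ...   | here refl = here refl
    ...   | there y∈  = there (∈-++⁺ˡ y∈)
    forestVertices-closed (h ∷ hs) x∈ xy | inj₂ x∈hs with forestVertices-closed hs x∈hs xy
    ...   | here refl = here refl
    ...   | there y∈  = there (∈-++⁺ʳ (vertices h) y∈)

  -- The listed vertices are distinct by acyclicity and exhaust `P` by connectedness.
  rooted-size : Rooted P v u T → openings (code T) ≡ n
  rooted-size {v} (rooted as bs {Ts} eq hs) = begin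
    openings (code (node Ts))           ≡⟨ openings-node Ts ⟩
    suc (size Ts)                       ≡⟨ cong suc (length-forestVertices hs) ⟨
    length (v ∷ forestVertices hs)      ≡⟨ enumeration-length uniq (λ x → reach (here refl) (connected v x)) ⟩
    n                                   ∎
    where
    open ≡-Reasoning

    uniq : Unique (v ∷ forestVertices hs)
    uniq = node-unique hs (children-unique as eq) (children-adj as eq)

    reach : x ∈ v ∷ forestVertices hs → Star Adj x y → y ∈ v ∷ forestVertices hs
    reach x∈          ε         = x∈
    reach (here refl) (xz ◅ zy) =
      reach (there (roots∈forestVertices hs (∈-resp-↭ (rotation as eq) xz))) zy
    reach (there x∈)  (xz ◅ zy) = reach (forestVertices-closed hs x∈ xz) zy

  -- Changing the marked edge and the root.

  mutual
    hanging-functional : Hanging P v w T → Hanging P v w T′ → T ≡ T′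
    hanging-functional (hanging as bs eq hs) (hanging as′ bs′ eq′ hs′)
      with unique-split as (subst Unique eq (nbrs-unique _)) (trans (sym eq) eq′)
    ... | refl , refl = cong node (forest-functional hs hs′)

    forest-functional : Forest w cs Ts → Forest w cs Ts′ → Ts ≡ Ts′
    forest-functional []       []         = refl
    forest-functional (h ∷ hs) (h′ ∷ hs′) =
      cong₂ _∷_ (hanging-functional h h′) (forest-functional hs hs′)

  -- Rotating the root's forest to the order of `nbrs v` gives a reference forest that is the same
  -- for all marked edges at `v`.
  unmark : Rooted P v u T → ∃ λ Ts → Forest v (nbrs v) Ts × treeParity T ≡ treeParity (node Ts)
  unmark {u = u} (rooted as bs eq hs) with pointwise-++⁻ (u ∷ bs) hs
  ... | Us , Vs , refl , hs₁ , hs₂ =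
    Vs ++ Us , subst (λ cs → Forest _ cs _) (sym eq) (++⁺ hs₂ hs₁) ,
    trans (treeParity-node (Us ++ Vs))
      (trans (cong parity (inv-rotate Us Vs)) (sym (treeParity-node (Vs ++ Us))))

  treeParity-mark : Rooted P v u T → Rooted P v w T′ → treeParity T ≡ treeParity T′
  treeParity-mark R R′ with unmark R | unmark R′
  ... | Ts , hs , eq | Ts′ , hs′ , eq′ =
    trans eq (trans (cong (treeParity ∘ node) (forest-functional hs hs′)) (sym eq′))

  reroot : 2 ∣ n → Rooted P v w T → ∃ λ T′ → Rooted P w v T′ × treeParity T ≡ treeParity T′
  reroot 2∣n R@(rooted as bs eq (_∷_ {ys = Us} (hanging as′ bs′ {Ts} eq′ hs′) hs)) =
    -- The splittings of the two neighbour lists around the marked edge serve again with roles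
    -- exchanged: the old root hangs below `w` with its remaining subtrees.
    _ , rooted as′ bs′ eq′ (hanging as bs eq hs ∷ hs′) ,
    treeParity-reroot Ts Us (trans (cong parity (rooted-size R)) (even-parity 2∣n))

  -- Induction along a path between the roots: for each edge, mark it at the current root and then
  -- move the root across it.
  treeParity-constant : 2 ∣ n → Star Adj v w → Rooted P v u T → Rooted P w x T′ →
                        treeParity T ≡ treeParity T′
  treeParity-constant 2∣n ε         R R′ = treeParity-mark R R′
  treeParity-constant 2∣n (vy ◅ yw) R R′ with rooted-exists P vy
  ... | _ , R₁ with reroot 2∣n R₁
  ... | _ , R₂ , eq =
    trans (treeParity-mark R R₁) (trans eq (treeParity-constant 2∣n yw R₂ R′))

proposition2p2 : ∀ {n : ℕ} (P : PlaneTree n) → 2 ∣ n →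
    ∀ {r u r′ u′ : Fin n} {T T′ : PRTree} →
    Rooted P r u T → Rooted P r′ u′ T′ →
    treeParity T ≡ treeParity T′
proposition2p2 P 2∣n = treeParity-constant P 2∣n (PlaneTree.connected P _ _)
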